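{- For $s=6$, let $p_i\,(>0)$, $a_i\,(>0)$ and $\mu_i\,(>0)$ $(i=1,2,3,4,5,6)$ be integers as in the distance-integrality criterion for complete multipartite graphs, i.e. $-2<p_1-2<\mu_1<p_2-2<\mu_2<\cdots<p_5-2<\mu_5<p_6-2<\mu_6<+\infty$ and $a_k=\frac{\prod_{i=1}^{6}(\mu_i-p_k+2)}{p_k\prod_{i=1,i\ne k}^{6}(p_i-p_k)}$ for $k=1,\dots,6$. Then for any positive integer $q$, the complete multipartite graphs $K_{a_1\cdot p_1q,\,a_2\cdot p_2q,\,a_3\cdot p_3q,\,a_4\cdot p_4q,\,a_5\cdot p_5q,\,a_6\cdot p_6q}$ with $qn\,(=q\sum_{i=1}^{6}a_ip_i)$ vertices are distance integral if $p_1=2$, $p_2=5$, $p_3=11$, $p_4=18$, $p_5=21$, $p_6=23$, $\mu_1=1$, $\mu_2=7$, $\mu_3=12$, $\mu_4=18$, $\mu_5=20$, $\mu_6=9598038t+53979$, $a_1=418600t+4735$, $a_2=260015t+2941$, $a_3=45448t+514$, $a_4=52440t+593$, $a_5=18837t+213$, $a_6=34580t+391$, $n=\sum_{i=1}^{6}a_ip_i=829920t+9387$, where $t$ is a nonnegative integer.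
   Context: For a simple connected undirected graph $G$ with vertices $v_1,\dots,v_N$, the distance matrix $D(G)$ is the $N\times N$ matrix whose $(i,j)$-entry is the length $d_{ij}$ of a shortest path between $v_i$ and $v_j$ (so $d_{ii}=0$). $G$ is called distance integral if all eigenvalues of $D(G)$ are integers. For distinct positive integers $p_1<\dots<p_s$ and positive integers $a_1,\dots,a_s$, $K_{a_1\cdot p_1,\dots,a_s\cdot p_s}$ denotes the complete multipartite graph having exactly $a_i$ parts of size $p_i$ for each $i=1,\dots,s$ (two vertices are adjacent if and only if they lie in different parts). The distance-integrality criterion mentioned in the claim: $K_{a_1\cdot p_1,\dots,a_s\cdot p_s}$ is distance integral if and only if there exist integers $\mu_1,\dots,\mu_s$ with $-2<p_1-2<\mu_1<p_2-2<\mu_2<\cdots<p_s-2<\mu_s<+\infty$ such that the numbers $a_k=\frac{\prod_{i=1}^{s}(\mu_i-p_k+2)}{p_k\prod_{i=1,i\ne k}^{s}(p_i-p_k)}$, $k=1,\dots,s$, are positive integers.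
   Formalization: The printed μ_6=9598038t+53979 contradicts the a_k formulas for t>0, and n=829920t+9387 is Σa_i, not Σa_i p_i; the formal statement uses μ_6=4772040t+53979 and n=4772040t+53969, with the same graphs for all t and q. -}

module Defs where

open import Level using (Level; _⊔_; 0ℓ) renaming (suc to lsuc)
open import Algebra.Apartness.Bundles using (HeytingField; module HeytingCommutativeRing)
import Algebra.Bundles as Bundles
import Algebra.Definitions.RawMonoid as RawMonoidDefs
open import Data.Nat.Base as ℕ using (ℕ; zero; suc)
open import Data.Integer.Base as ℤ using (ℤ; +_; -[1+_])
open import Data.Fin.Base using (Fin; zero; suc; inject₁)
open import Data.Fin.Properties using (+↔⊎; *↔×)
open import Data.List.Base as List using (List)
open import Data.List.Relation.Unary.Unique.Propositional using (Unique)
open import Data.Product.Base using (Σ; ∃; ∃-syntax; Σ-syntax; _×_; _,_)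
open import Data.Sum.Base using (_⊎_; inj₁; inj₂)
open import Data.Vec.Functional using (Vector; foldr; removeAt)
open import Function.Base using (_∘_)
open import Function.Bundles using (_↔_; mk↔ₛ′; module Inverse)
open import Function.Construct.Composition using (_↔-∘_)
open import Relation.Binary.Core using (Rel)
open import Relation.Binary.Definitions using (Symmetric; Irreflexive)
open import Relation.Binary.PropositionalEquality using (_≡_; _≢_; refl; sym; cong)

------------------------------------------------------------------------
-- Finite simple graphs and distance

record Graph : Set₁ where
  infix 4 _~_
  field
    Vertex   : Set
    _~_      : Rel Vertex 0ℓ
    ~-sym    : Symmetric _~_
    ~-irrefl : Irreflexive _≡_ _~_
    order    : ℕ
    labels   : Fin order ↔ Vertex

  -- the vertices v₁ , … , v_N
  vertex : Fin order → Vertex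
  vertex = Inverse.to labels

  infixr 5 _∷_
  data Walk : Vertex → Vertex → ℕ → Set where
    []  : ∀ {u} → Walk u u 0
    _∷_ : ∀ {u v w n} → u ~ v → Walk v w n → Walk u w (suc n)

  visited : ∀ {u v n} → Walk u v n → List Vertex
  visited ([] {u})    = u List.∷ List.[]
  visited (_∷_ {u} _ π) = u List.∷ visited π

  Path : Vertex → Vertex → ℕ → Set
  Path u v n = Σ[ π ∈ Walk u v n ] Unique (visited π)

  IsDistance : Vertex → Vertex → ℕ → Set
  IsDistance u v d = Path u v d × (∀ {n} → Path u v n → d ℕ.≤ n)

  -- There is at most one such D, and there is one only if the graph is
  -- connected.
  IsDistanceMatrix : (Fin order → Fin order → ℕ) → Set
  IsDistanceMatrix D = ∀ i j → IsDistance (vertex i) (vertex j) (D i j)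

------------------------------------------------------------------------
-- Eigenvalues
--
-- The real (or complex) numbers are not available, so eigenvalues of an
-- integer matrix are taken in an arbitrary field of characteristic zero;
-- ℝ, ℂ and all number fields are instances.  Every eigenvalue of such a
-- matrix is algebraic over ℚ, so "all eigenvalues are integers" means the
-- same over ℂ as over all these fields together.

module Eigenvalues {c ℓ₁ ℓ₂} (F : HeytingField c ℓ₁ ℓ₂) where
  open HeytingField F

  private
    module R = Bundles.CommutativeRing
      (HeytingCommutativeRing.commutativeRing heytingCommutativeRing)

  open RawMonoidDefs (Bundles.Monoid.rawMonoid R.+-monoid) public
    using (sum) renaming (_×_ to _·_)

  CharacteristicZero : Set ℓ₂
  CharacteristicZero = ∀ n → (suc n · 1#) # 0#

  fromℤ : ℤ → Carrier
  fromℤ (+ n)    = n · 1#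
  fromℤ -[1+ n ] = - (suc n · 1#)

  IsEigenvalue : ∀ {N} → (Fin N → Fin N → ℕ) → Carrier → Set (c ⊔ ℓ₁ ⊔ ℓ₂)
  IsEigenvalue {N} D x =
    Σ[ v ∈ Vector Carrier N ]
      (∃[ i ] v i # 0#) ×
      (∀ i → sum (λ j → (D i j · 1#) * v j) ≈ x * v i)

  AllEigenvaluesIntegers : ∀ {N} → (Fin N → Fin N → ℕ) → Set (c ⊔ ℓ₁ ⊔ ℓ₂)
  AllEigenvaluesIntegers D = ∀ x → IsEigenvalue D x → ∃[ m ] x ≈ fromℤ m

DistanceIntegral : (c ℓ₁ ℓ₂ : Level) → Graph → Set (lsuc (c ⊔ ℓ₁ ⊔ ℓ₂))
DistanceIntegral c ℓ₁ ℓ₂ G =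
  ∃[ D ] IsDistanceMatrix D ×
    ((F : HeytingField c ℓ₁ ℓ₂) → let open Eigenvalues F in
      CharacteristicZero → AllEigenvaluesIntegers D)
  where open Graph G

------------------------------------------------------------------------
-- Complete multipartite graphs

open RawMonoidDefs ℕ.+-0-rawMonoid public using (sum)

Fin-sum↔Σ : ∀ {s} (n : Vector ℕ s) → Fin (sum n) ↔ Σ (Fin s) (Fin ∘ n)
Fin-sum↔Σ {zero}  n = mk↔ₛ′ (λ ()) (λ ()) (λ ()) (λ ())
Fin-sum↔Σ {suc s} n = mk↔ₛ′ to from to∘from from∘to ↔-∘ +↔⊎
  where
  module IH = Inverse (Fin-sum↔Σ (n ∘ suc))

  to : Fin (n zero) ⊎ Fin (sum (n ∘ suc)) → Σ (Fin (suc s)) (Fin ∘ n)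
  to (inj₁ k) = zero , k
  to (inj₂ k) = let (i , j) = IH.to k in suc i , j

  from : Σ (Fin (suc s)) (Fin ∘ n) → Fin (n zero) ⊎ Fin (sum (n ∘ suc))
  from (zero  , k) = inj₁ k
  from (suc i , k) = inj₂ (IH.from (i , k))

  to∘from : ∀ x → to (from x) ≡ x
  to∘from (zero  , k) = refl
  to∘from (suc i , k) =
    cong (λ (i , j) → suc i , j) (IH.strictlyInverseˡ (i , k))

  from∘to : ∀ x → from (to x) ≡ x
  from∘to (inj₁ k) = refl
  from∘to (inj₂ k) = cong inj₂ (IH.strictlyInverseʳ k)

-- K a p is K_{a₁·p₁,…,a_s·p_s}.  The vertex (i , j , k) is the k-th vertex of
-- the j-th of the a i parts of size p i.
K : ∀ {s} → Vector ℕ s → Vector ℕ s → Graph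
K {s} a p = record
  { Vertex   = Vertex
  ; _~_      = λ u v → part u ≢ part v
  ; ~-sym    = λ u≁v → u≁v ∘ sym
  ; ~-irrefl = λ u≡v u~v → u~v (cong part u≡v)
  ; order    = sum (λ i → a i ℕ.* p i)
  ; labels   = mk↔ₛ′ to from to∘from from∘to ↔-∘ Fin-sum↔Σ (λ i → a i ℕ.* p i)
  }
  where
  Vertex : Set
  Vertex = Σ[ i ∈ Fin s ] Fin (a i) × Fin (p i)

  part : Vertex → Σ (Fin s) (Fin ∘ a)
  part (i , j , _) = i , j

  module Block i = Inverse (*↔× {a i} {p i})

  to : Σ[ i ∈ Fin s ] Fin (a i ℕ.* p i) → Vertex
  to (i , k) = i , Block.to i k

  from : Vertex → Σ[ i ∈ Fin s ] Fin (a i ℕ.* p i)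
  from (i , k) = i , Block.from i k

  to∘from : ∀ x → to (from x) ≡ x
  to∘from (i , k) = cong (i ,_) (Block.strictlyInverseˡ i k)

  from∘to : ∀ x → from (to x) ≡ x
  from∘to (i , k) = cong (i ,_) (Block.strictlyInverseʳ i k)

------------------------------------------------------------------------
-- The data of the distance-integrality criterion

∏ : ∀ {n} → Vector ℤ n → ℤ
∏ = foldr ℤ._*_ ℤ.1ℤ

record CriterionData {m} (a p : Vector ℕ (suc m)) (μ : Vector ℤ (suc m)) : Set where
  private
    p′ : Vector ℤ (suc m)
    p′ i = + p i
  field
    p>0     : ∀ k → 0 ℕ.< p k
    a>0     : ∀ k → 0 ℕ.< a k
    μ>0     : ∀ k → + 0 ℤ.< μ k
    -2<p₁-2 : ℤ.- (+ 2) ℤ.< p′ zero ℤ.- + 2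
    p-2<μ   : ∀ k → p′ k ℤ.- + 2 ℤ.< μ k
    μ<p-2   : ∀ (k : Fin m) → μ (inject₁ k) ℤ.< p′ (suc k) ℤ.- + 2
    -- a k is the quotient of the right-hand side by the factor
    -- p k * ∏_{i ≠ k} (p i - p k), which is nonzero because p is strictly
    -- increasing and positive.
    a-eq    : ∀ k →
      + a k ℤ.* (p′ k ℤ.* ∏ (removeAt (λ i → p′ i ℤ.- p′ k) k))
        ≡ ∏ (λ i → μ i ℤ.- p′ k ℤ.+ + 2)

module Submission where

-- Two distinct vertices of K = K_{a₁·m₁,…} are at distance 2 if they lie in the
-- same part, and at distance 1 otherwise.  So if D v = x v, S is the sum of all
-- entries of v, P that of the entries on the part of u, and z = x + 2, then
-- z v_u = S + P; summing over a part of size m i gives (z - m i) P = m i S, and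
-- summing over all parts
--   (∏ᵢ (z - m i) - Σᵢ a i m i ∏_{l ≠ i} (z - m l)) S = 0.
-- For m i = p i q the polynomial on the left is ∏ₗ (z - (μ l + 2) q), hence any
-- entry v_u is annihilated by z (z - m i) ∏ₗ (z - (μ l + 2) q), i being the type
-- of u.  Its roots are distinct integers, and z must be one of them.

open import Defs
open import Level using (Level)
open import Algebra.Apartness.Bundles using (HeytingField; module HeytingCommutativeRing)
import Algebra.Apartness.Properties.HeytingCommutativeRing as HeytingProperties
open import Algebra.Bundles using (CommutativeMonoid; CommutativeRing; CommutativeSemiring; RawRing)
import Algebra.Properties.CommutativeMonoid.Sum as CommutativeMonoidSum
import Algebra.Properties.Monoid.Sum as MonoidSum
import Algebra.Properties.Ring as RingProperties
import Algebra.Properties.Semiring.Mult as SemiringMult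
import Algebra.Properties.Semiring.Sum as SemiringSum
import Algebra.Solver.Ring as RingSolver
open import Algebra.Solver.Ring.AlmostCommutativeRing
  using (_-Raw-AlmostCommutative⟶_; fromCommutativeSemiring)
import Algebra.Solver.Ring.NaturalCoefficients.Default as SemiringSolver
open import Data.Bool.Base using (true; false; if_then_else_)
open import Data.Fin.Base
  using (Fin; zero; suc; _↑ˡ_; _↑ʳ_; combine; remQuot; punchIn; inject₁; fromℕ<)
open import Data.Fin.Patterns using (0F; 1F; 2F; 3F; 4F; 5F)
open import Data.Fin.Properties
  using (splitAt-↑ˡ; splitAt-↑ʳ; remQuot-combine; suc-injective; punchIn-injective; all?)
  renaming (_≟_ to _≟ᶠ_)
open import Data.Integer.Base as ℤ using (ℤ; +_; _⊖_; +<+)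
import Data.Integer.Properties as ℤ
open import Data.List.Relation.Unary.All using () renaming ([] to ε; _∷_ to _◅_)
open import Data.List.Relation.Unary.AllPairs using () renaming ([] to ε; _∷_ to _◅_)
open import Data.Maybe.Base using (Maybe; from-just; map)
open import Data.Nat.Base as ℕ using (ℕ; zero; suc; z≤n; s≤s)
import Data.Nat.Properties as ℕ
open import Data.Product.Base using (Σ-syntax; ∃-syntax; _×_; _,_)
open import Data.Product.Properties using (≡-dec)
open import Data.Sum.Base using (_⊎_; [_,_]′)
open import Data.Vec.Base as Vec using (Vec)
open import Data.Vec.Functional using (Vector; []; _∷_; foldr; removeAt; init)
open import Function.Base using (_∘_; id)
open import Function.Bundles using (module Inverse)
open import Relation.Binary.Consequences using (dec⇒weaklyDec)
open import Relation.Binary.Definitions using (DecidableEquality)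
open import Relation.Binary.PropositionalEquality as ≡ using (_≡_; _≢_)
import Relation.Binary.Reasoning.Setoid as ≈-Reasoning
open import Relation.Nullary.Decidable
  using (Dec; yes; no; does; dec-true; dec-false; from-yes; _×-dec_; _⊎-dec_)
open import Relation.Nullary.Negation.Core using (contradiction)

-- Finite sums, up to sums over all vertices

module ℤΠ = MonoidSum ℤ.*-1-monoid
module ℕΣ = SemiringSum ℕ.+-*-semiring

module FiniteSums {c ℓ} (M : CommutativeMonoid c ℓ) where
  open CommutativeMonoid M
    renaming (_∙_ to _+_; ε to 0#; ∙-cong to +-cong; ∙-congˡ to +-congˡ;
              assoc to +-assoc; identityˡ to +-identityˡ; identityʳ to +-identityʳ)
  open CommutativeMonoidSum M renaming (sum to Σ#)
  open ≈-Reasoning setoid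

  sum-zero : ∀ {n} {f : Vector Carrier n} → (∀ i → f i ≈ 0#) → Σ# f ≈ 0#
  sum-zero {n} f≈0 = trans (sum-cong-≋ f≈0) (sum-replicate-zero n)

  sum-select : ∀ {n} {f : Vector Carrier n} i → (∀ j → i ≢ j → f j ≈ 0#) → Σ# f ≈ f i
  sum-select {f = f} zero    f≈0 =
    trans (+-congˡ (sum-zero (λ j → f≈0 (suc j) (λ ())))) (+-identityʳ (f zero))
  sum-select {f = f} (suc i) f≈0 =
    trans (+-cong (f≈0 zero (λ ())) (sum-select i (λ j i≢j → f≈0 (suc j) (i≢j ∘ suc-injective))))
          (+-identityˡ (f (suc i)))

  sum-splitAt : ∀ m {n} (f : Vector Carrier (m ℕ.+ n)) →
                Σ# f ≈ Σ# (λ i → f (i ↑ˡ n)) + Σ# (λ i → f (m ↑ʳ i))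
  sum-splitAt zero    f = sym (+-identityˡ _)
  sum-splitAt (suc m) f = trans (+-congˡ (sum-splitAt m (f ∘ suc))) (sym (+-assoc _ _ _))

  sum-combine : ∀ m {n} (f : Vector Carrier (m ℕ.* n)) →
                Σ# f ≈ Σ# {m} (λ i → Σ# (λ j → f (combine i j)))
  sum-combine zero        f = refl
  sum-combine (suc m) {n} f =
    trans (sum-splitAt n f) (+-congˡ (sum-combine m (λ i → f (n ↑ʳ i))))

  sum-Fin-sum↔Σ : ∀ {s} (n : Vector ℕ s) (g : Σ[ i ∈ Fin s ] Fin (n i) → Carrier) →
                  Σ# (g ∘ Inverse.to (Fin-sum↔Σ n)) ≈ Σ# (λ i → Σ# (λ k → g (i , k)))
  sum-Fin-sum↔Σ {zero}  n g = refl
  sum-Fin-sum↔Σ {suc s} n g = trans (sum-splitAt (n zero) _)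
    (+-cong (reflexive (sum-cong-≗ (≡.cong g ∘ to-↑ˡ)))
            (trans (reflexive (sum-cong-≗ (≡.cong g ∘ to-↑ʳ)))
                   (sum-Fin-sum↔Σ (n ∘ suc) (λ (i , k) → g (suc i , k)))))
    where
    to-↑ˡ : ∀ k → Inverse.to (Fin-sum↔Σ n) (k ↑ˡ sum (n ∘ suc)) ≡ (zero , k)
    to-↑ˡ k rewrite splitAt-↑ˡ (n zero) k (sum (n ∘ suc)) = ≡.refl

    to-↑ʳ : ∀ k → let (i , l) = Inverse.to (Fin-sum↔Σ (n ∘ suc)) k in
            Inverse.to (Fin-sum↔Σ n) (n zero ↑ʳ k) ≡ (suc i , l)
    to-↑ʳ k rewrite splitAt-↑ʳ (n zero) (sum (n ∘ suc)) k = ≡.refl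

  -- Matrix rows are indexed by `Fin order`, whereas parts are visible only on triples (i , j , k);
  -- this passes from one to the other.
  sum-vertices : ∀ {s} (a m : Vector ℕ s) (g : Graph.Vertex (K a m) → Carrier) →
                 Σ# (g ∘ Graph.vertex (K a m))
                   ≈ Σ# (λ i → Σ# (λ j → Σ# (λ k → g (i , j , k))))
  sum-vertices a m g = trans (sum-Fin-sum↔Σ (λ i → a i ℕ.* m i) (g ∘ vertex)) (sum-cong-≋ λ i →
    trans (sum-combine (a i) (λ k → g (vertex (i , k)))) (sum-cong-≋ λ j → sum-cong-≋ λ k →
    reflexive (≡.cong (λ jk → g (i , jk)) (remQuot-combine {a i} j k))))
    where
    vertex : Σ[ i ∈ Fin _ ] Fin (a i ℕ.* m i) → Graph.Vertex (K a m)
    vertex (i , k) = i , remQuot (m i) k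

-- Distances in complete multipartite graphs

module CompleteMultipartite {s} (a m : Vector ℕ s) where
  open Graph (K a m) renaming ([] to ε; _∷_ to _◅_)

  part : Vertex → Σ[ i ∈ Fin s ] Fin (a i)
  part (i , j , _) = i , j

  _≟_ : DecidableEquality Vertex
  _≟_ = ≡-dec _≟ᶠ_ (≡-dec _≟ᶠ_ _≟ᶠ_)

  _≟ₚ_ : DecidableEquality (Σ[ i ∈ Fin s ] Fin (a i))
  _≟ₚ_ = ≡-dec _≟ᶠ_ _≟ᶠ_

  distance : Vertex → Vertex → ℕ
  distance u w =
    if does (u ≟ w) then 0 else if does (part u ≟ₚ part w) then 2 else 1

  distanceMatrix : Fin order → Fin order → ℕ
  distanceMatrix i j = distance (vertex i) (vertex j)

  -- Distinct u and w in one part are joined through any neighbour of u: it lies outside that part,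
  -- so it is adjacent to w as well.
  distance-isDistance : (∀ u → ∃[ w ] u ~ w) → ∀ u w → IsDistance u w (distance u w)
  distance-isDistance neighbour u w with u ≟ w
  ... | yes ≡.refl = (ε , ε ◅ ε) , λ _ → z≤n
  ... | no u≢w with part u ≟ₚ part w
  ...   | no u~w = (u~w ◅ ε , (u≢w ◅ ε) ◅ ε ◅ ε) ,
    λ { (ε , _) → contradiction ≡.refl u≢w ; (_ ◅ _ , _) → s≤s z≤n }
  ...   | yes u≁w = let (v , u~v) = neighbour u in
    (_◅_ {v = v} u~v ((u~v ∘ ≡.trans u≁w ∘ ≡.sym) ◅ ε) ,
      (u~v ∘ ≡.cong part ◅ u≢w ◅ ε) ◅
      ((λ v≡w → u~v (≡.trans u≁w (≡.cong part (≡.sym v≡w)))) ◅ ε) ◅ ε ◅ ε) ,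
    λ { (ε , _) → contradiction ≡.refl u≢w
      ; (u~w ◅ ε , _) → contradiction u≁w u~w
      ; (_ ◅ _ ◅ _ , _) → s≤s (s≤s z≤n) }

-- Apartness and roots of products in a Heyting field

commutativeRingOf : ∀ {c ℓ₁ ℓ₂} → HeytingField c ℓ₁ ℓ₂ → CommutativeRing c ℓ₁
commutativeRingOf F =
  HeytingCommutativeRing.commutativeRing (HeytingField.heytingCommutativeRing F)

module FieldProperties {c ℓ₁ ℓ₂} (F : HeytingField c ℓ₁ ℓ₂) where
  open HeytingField F hiding (zero)
  open Eigenvalues F
  open HeytingProperties heytingCommutativeRing

  open CommutativeRing (commutativeRingOf F) using (semiring; ring; *-commutativeMonoid)
  open RingProperties ring using () renaming (x∙y⁻¹≈ε⇒x≈y to x-y≈0⇒x≈y)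
  open SemiringMult semiring using (×-homo-+)
  open CommutativeMonoidSum *-commutativeMonoid
    using (sum-remove) renaming (sum to Π#)
  open ≈-Reasoning setoid

  -- Apartness amounts to invertibility of the difference, so it only remains to identify (x - y) -
  -- 0 with x - y.
  x-y#0⇒x#y : ∀ {x y} → x - y # 0# → x # y
  x-y#0⇒x#y {x} {y} x-y#0 with #⇒invertible x-y#0
  ... | z , z*≈1 , _ = invertibleˡ⇒# (z , trans (*-congˡ (sym (x-0≈x (x - y)))) z*≈1)

  x#y⇒x-y#0 : ∀ {x y} → x # y → x - y # 0#
  x#y⇒x-y#0 {x} {y} x#y with #⇒invertible x#y
  ... | z , z*≈1 , _ = invertibleˡ⇒# (z , trans (*-congˡ (x-0≈x (x - y))) z*≈1)

  x#0∧xy≈0⇒y≈0 : ∀ {x y} → x # 0# → x * y ≈ 0# → y ≈ 0#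
  x#0∧xy≈0⇒y≈0 {x} {y} x#0 xy≈0 with #⇒invertible x#0
  ... | z , z*≈1 , _ = begin
    y                  ≈⟨ *-identityˡ y ⟨
    1# * y             ≈⟨ *-congʳ z*≈1 ⟨
    z * (x - 0#) * y   ≈⟨ *-congʳ (*-congˡ (x-0≈x x)) ⟩
    z * x * y          ≈⟨ *-assoc z x y ⟩
    z * (x * y)        ≈⟨ *-congˡ xy≈0 ⟩
    z * 0#             ≈⟨ zeroʳ z ⟩
    0#                 ∎

  -- With n = m + 1 + k the difference is `suc k · 1#`, apart from 0 in characteristic zero. Thus
  -- distinct natural roots become apart in the field.
  <⇒·1# : CharacteristicZero → ∀ {m n} → m ℕ.< n → (n · 1#) # (m · 1#)
  <⇒·1# char0 {m} m<n with ℕ.m≤n⇒∃[o]m+o≡n m<n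
  ... | k , ≡.refl = x-y#0⇒x#y (#-congʳ (sym difference) (char0 k))
    where
    difference : suc (m ℕ.+ k) · 1# - m · 1# ≈ suc k · 1#
    difference = begin
      suc (m ℕ.+ k) · 1# - m · 1#      ≡⟨ ≡.cong (λ l → suc l · 1# - m · 1#) (ℕ.+-comm m k) ⟩
      (suc k ℕ.+ m) · 1# - m · 1#      ≈⟨ +-congʳ (×-homo-+ 1# (suc k) m) ⟩
      suc k · 1# + m · 1# - m · 1#     ≈⟨ +-assoc _ _ _ ⟩
      suc k · 1# + (m · 1# - m · 1#)   ≈⟨ +-congˡ (-‿inverseʳ _) ⟩
      suc k · 1# + 0#                  ≈⟨ +-identityʳ _ ⟩
      suc k · 1#                       ∎

  -- The cofactor y absorbs factors cancelled during the induction; at the start it is an entry of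
  -- the eigenvector.
  HasRoot : ℕ → Set _
  HasRoot n = ∀ (r : Vector Carrier n) → (∀ i j → i ≢ j → r i # r j) →
              ∀ y z → y # 0# → y * Π# (λ i → z - r i) ≈ 0# → ∃[ i ] z ≈ r i

  -- When z is apart from `r k`, the factor z - r k is apart from 0 and merges into y, leaving one
  -- root fewer.
  cancel : ∀ {n} → HasRoot n → ∀ (r : Vector Carrier (suc n)) → (∀ i j → i ≢ j → r i # r j) →
           ∀ k y z → y # 0# → y * Π# (λ i → z - r i) ≈ 0# → z # r k → ∃[ i ] z ≈ r i
  cancel hasRoot r r# k y z y#0 yΠ≈0 z#rk =
    let i , z≈ri = hasRoot (removeAt r k) (λ i j i≢j → r# _ _ (i≢j ∘ punchIn-injective k i j))
                     (y * (z - r k)) z (x#0y#0→xy#0 y#0 (x#y⇒x-y#0 z#rk)) y′Π′≈0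
    in punchIn k i , z≈ri
    where
    y′Π′≈0 : y * (z - r k) * Π# (λ i → z - removeAt r k i) ≈ 0#
    y′Π′≈0 = begin
      y * (z - r k) * Π# (λ i → z - removeAt r k i)
        ≈⟨ *-assoc _ _ _ ⟩
      y * ((z - r k) * Π# (λ i → z - removeAt r k i))
        ≈⟨ *-congˡ (sum-remove {i = k} (λ i → z - r i)) ⟨
      y * Π# (λ i → z - r i)
        ≈⟨ yΠ≈0 ⟩
      0# ∎

  -- Equality with z is not decidable; instead, of two roots that are apart
  -- from each other, one is apart from z, and its factor can be cancelled.
  root : ∀ n → HasRoot (suc n)
  root zero    r r# y z y#0 yΠ≈0 =
    zero , x-y≈0⇒x≈y _ _ (trans (sym (*-identityʳ _)) (x#0∧xy≈0⇒y≈0 y#0 yΠ≈0))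
  root (suc n) r r# y z y#0 yΠ≈0 =
    [ (λ r₀#z → cancel (root n) r r# 0F y z y#0 yΠ≈0 (#-sym r₀#z))
    , (λ z#r₁ → cancel (root n) r r# 1F y z y#0 yΠ≈0 z#r₁)
    ]′ (#-cotrans (r# 0F 1F (λ ())) z)

  -- Fits the shape of `V-annihilated`: two separate factors, then one value g standing for the
  -- remaining product.
  root-factors : ∀ {n} (r : Vector Carrier (2 ℕ.+ n)) → (∀ i j → i ≢ j → r i # r j) →
    ∀ {y z f₀ f₁ g} → z - r 0F ≈ f₀ → z - r 1F ≈ f₁ → Π# (λ i → z - r (suc (suc i))) ≈ g →
    y # 0# → y * (f₀ * (f₁ * g)) ≈ 0# → ∃[ i ] z ≈ r i
  root-factors r r# f₀≈ f₁≈ g≈ y#0 yf₀f₁g≈0 = root _ r r# _ _ y#0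
    (trans (*-congˡ (*-cong f₀≈ (*-cong f₁≈ g≈))) yf₀f₁g≈0)

  -- Adding `n · 1#` on the left avoids a case split on the sign of m - n.
  fromℤ-⊖ : ∀ m n → fromℤ (m ⊖ n) + n · 1# ≈ m · 1#
  fromℤ-⊖ m       zero    = +-identityʳ (m · 1#)
  fromℤ-⊖ zero    (suc n) = -‿inverseˡ (suc n · 1#)
  fromℤ-⊖ (suc m) (suc n) = begin
    fromℤ (suc m ⊖ suc n) + suc n · 1#   ≡⟨ ≡.cong (λ k → fromℤ k + suc n · 1#)
                                              (ℤ.[1+m]⊖[1+n]≡m⊖n m n) ⟩
    fromℤ (m ⊖ n) + (1# + n · 1#)        ≈⟨ +-congˡ (+-comm 1# (n · 1#)) ⟩
    fromℤ (m ⊖ n) + (n · 1# + 1#)        ≈⟨ +-assoc _ _ _ ⟨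
    fromℤ (m ⊖ n) + n · 1# + 1#          ≈⟨ +-congʳ (fromℤ-⊖ m n) ⟩
    m · 1# + 1#                          ≈⟨ +-comm _ _ ⟩
    suc m · 1#                           ∎

-- Action of D + 2 I on an eigenvector

module MultipartiteSpectrum {c ℓ₁ ℓ₂} (F : HeytingField c ℓ₁ ℓ₂) {s} (a m : Vector ℕ s) where
  open HeytingField F hiding (zero)
  open Eigenvalues F hiding (sum)
  open CompleteMultipartite a m
  open Graph (K a m) using (Vertex; vertex; labels; order)
  open CommutativeRing (commutativeRingOf F) using (semiring; commutativeSemiring; +-commutativeMonoid)
  open SemiringMult semiring using (×-assoc-*; ×-congʳ)
  open SemiringSum semiring
    using (sum-cong-≋; sum-replicate; *-distribˡ-sum; ∑-distrib-+) renaming (sum to Σ#)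
  open FiniteSums +-commutativeMonoid
  open SemiringSolver commutativeSemiring using (solve; _:+_; _:*_; _:=_; con)
  open ≈-Reasoning setoid

  ∑ : (Vertex → Carrier) → Carrier
  ∑ g = Σ# (λ i → Σ# (λ j → Σ# (λ k → g (i , j , k))))

  ∑-cong : ∀ {g h : Vertex → Carrier} → (∀ u → g u ≈ h u) → ∑ g ≈ ∑ h
  ∑-cong g≈h = sum-cong-≋ {s} λ i → sum-cong-≋ {a i} λ j → sum-cong-≋ {m i} λ k → g≈h (i , j , k)

  ∑-+ : ∀ (g h : Vertex → Carrier) → ∑ (λ u → g u + h u) ≈ ∑ g + ∑ h
  ∑-+ g h = trans
    (sum-cong-≋ {s} λ i → trans
      (sum-cong-≋ {a i} λ j → ∑-distrib-+ {m i} _ _)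
      (∑-distrib-+ {a i} _ _))
    (∑-distrib-+ {s} _ _)

  ∑-select-part : ∀ {g : Vertex → Carrier} i j → (∀ u → (i , j) ≢ part u → g u ≈ 0#) →
                  ∑ g ≈ Σ# (λ k → g (i , j , k))
  ∑-select-part i j g≈0 = trans
    (sum-select i λ i′ i≢i′ → sum-zero {a i′} λ j′ → sum-zero {m i′} λ k →
      g≈0 (i′ , j′ , k) λ { ≡.refl → i≢i′ ≡.refl })
    (sum-select j λ j′ j≢j′ → sum-zero {m i} λ k →
      g≈0 (i , j′ , k) λ { ≡.refl → j≢j′ ≡.refl })

  sum-const : ∀ n y → Σ# {n} (λ _ → y) ≈ n · 1# * y
  sum-const n y = trans (sum-replicate n)
    (trans (×-congʳ n (sym (*-identityˡ y))) (sym (×-assoc-* n 1# y)))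

  indicator : ∀ {p} {P : Set p} → Dec P → Carrier → Carrier
  indicator d x = if does d then x else 0#

  indicator-yes : ∀ {p} {P : Set p} (d : Dec P) {x} → P → indicator d x ≈ x
  indicator-yes d p rewrite dec-true d p = refl

  indicator-no : ∀ {p} {P : Set p} (d : Dec P) {x} → (P → _) → indicator d x ≈ 0#
  indicator-no d ¬p rewrite dec-false d ¬p = refl

  -- D + 2 I is the all-ones matrix plus the block diagonal matrix of all-ones
  -- blocks on the parts.
  distance-indicator : ∀ u w x →
    distance u w · 1# * x + indicator (u ≟ w) (x + x) ≈ x + indicator (part u ≟ₚ part w) x
  distance-indicator u w x with u ≟ w
  ... | yes ≡.refl = trans (trans (+-congʳ (zeroˡ x)) (+-identityˡ _))
    (+-congˡ (sym (indicator-yes (part u ≟ₚ part u) ≡.refl)))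
  ... | no _ with does (part u ≟ₚ part w)
  ...   | true  = solve 1 (λ x → (con 1 :+ (con 1 :+ con 0)) :* x :+ con 0 := x :+ x) refl x
  ...   | false = solve 1 (λ x → (con 1 :+ con 0) :* x :+ con 0 := x :+ con 0) refl x

  module Eigenvector {x} (v : Vector Carrier order)
    (Dv≈xv : ∀ i → Σ# (λ j → (distanceMatrix i j · 1#) * v j) ≈ x * v i) where

    V : Vertex → Carrier
    V u = v (Inverse.from labels u)

    S : Carrier
    S = ∑ V

    P : ∀ i → Fin (a i) → Carrier
    P i j = Σ# (λ k → V (i , j , k))

    z : Carrier
    z = x + (1# + 1#)

    V-vertex : ∀ i → V (vertex i) ≡ v i
    V-vertex i = ≡.cong v (Inverse.strictlyInverseʳ labels i)

    eigen : ∀ u → ∑ (λ w → distance u w · 1# * V w) ≈ x * V u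
    -- Once u is matched with `vertex i`, `V u` reduces to `v i`.
    eigen u with Inverse.from labels u | Inverse.strictlyInverseˡ labels u
    ... | i | ≡.refl = begin
      ∑ (λ w → distance (vertex i) w · 1# * V w)
        ≈⟨ sum-vertices a m (λ w → distance (vertex i) w · 1# * V w) ⟨
      Σ# (λ j → distanceMatrix i j · 1# * V (vertex j))
        ≈⟨ sum-cong-≋ (λ j → *-congˡ (reflexive (V-vertex j))) ⟩
      Σ# (λ j → distanceMatrix i j · 1# * v j)
        ≈⟨ Dv≈xv i ⟩
      x * v i ∎

    -- Row u of D + 2 I applied to v: `distance-indicator` is summed over w, where one indicator
    -- keeps only w = u and the other keeps the part of u.
    zV≈S+P : ∀ i j k → z * V (i , j , k) ≈ S + P i j
    zV≈S+P i j k = begin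
      z * V u
        ≈⟨ solve 2 (λ x y → (x :+ con 2) :* y := x :* y :+ (y :+ y)) refl x (V u) ⟩
      x * V u + (V u + V u)
        ≈⟨ +-cong (eigen u) ∑-indicator ⟨
      ∑ (λ w → distance u w · 1# * V w) + ∑ (λ w → indicator (u ≟ w) (V w + V w))
        ≈⟨ ∑-+ _ _ ⟨
      ∑ (λ w → distance u w · 1# * V w + indicator (u ≟ w) (V w + V w))
        ≈⟨ ∑-cong (λ w → distance-indicator u w (V w)) ⟩
      ∑ (λ w → V w + indicator (part u ≟ₚ part w) (V w))
        ≈⟨ ∑-+ _ _ ⟩
      S + ∑ (λ w → indicator (part u ≟ₚ part w) (V w))
        ≈⟨ +-congˡ ∑-indicator-part ⟩
      S + P i j ∎
      where
      u : Vertex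
      u = i , j , k

      ∑-indicator : ∑ (λ w → indicator (u ≟ w) (V w + V w)) ≈ V u + V u
      ∑-indicator = trans
        (∑-select-part i j λ w i,j≢ → indicator-no (u ≟ w) (i,j≢ ∘ ≡.cong part))
        (trans (sum-select k λ k′ k≢k′ → indicator-no (u ≟ (i , j , k′)) λ { ≡.refl → k≢k′ ≡.refl })
               (indicator-yes (u ≟ u) ≡.refl))

      ∑-indicator-part : ∑ (λ w → indicator (part u ≟ₚ part w) (V w)) ≈ P i j
      ∑-indicator-part = trans
        (∑-select-part i j λ w → indicator-no (part u ≟ₚ part w))
        (sum-cong-≋ {m i} λ k′ → indicator-yes (part u ≟ₚ (i , j)) ≡.refl)

    zP≈m[S+P] : ∀ i j → z * P i j ≈ m i · 1# * (S + P i j)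
    zP≈m[S+P] i j = begin
      z * P i j                        ≈⟨ *-distribˡ-sum {m i} z _ ⟩
      Σ# (λ k → z * V (i , j , k))     ≈⟨ sum-cong-≋ {m i} (zV≈S+P i j) ⟩
      Σ# {m i} (λ _ → S + P i j)       ≈⟨ sum-const (m i) _ ⟩
      m i · 1# * (S + P i j)           ∎

-- Elimination to the secular equation

module SecularEquation {c ℓ₁ ℓ₂} (F : HeytingField c ℓ₁ ℓ₂) {s} (a m : Vector ℕ (suc s)) where
  open HeytingField F hiding (zero)
  open Eigenvalues F hiding (sum)
  open CompleteMultipartite a m using (distanceMatrix)
  open Graph (K a m) using (order)
  open CommutativeRing (commutativeRingOf F)
    using (semiring; commutativeSemiring; *-commutativeMonoid; +-commutativeMonoid)
  open CommutativeMonoidSum *-commutativeMonoid using (sum-remove) renaming (sum to Π#)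
  open SemiringSum semiring
    using (sum-cong-≋; *-distribˡ-sum; *-distribʳ-sum; ∑-distrib-+) renaming (sum to Σ#)
  open FiniteSums +-commutativeMonoid
  open SemiringSolver commutativeSemiring using (solve; _:+_; _:*_; _:=_)
  open ≈-Reasoning setoid

  -- A and u represent the multiplicities and the negated part sizes. Carrying - m i as u i keeps
  -- all identities within reach of the semiring solver.
  module _ {x} (v : Vector Carrier order)
    (Dv≈xv : ∀ i → Σ# (λ j → (distanceMatrix i j · 1#) * v j) ≈ x * v i)
    (A u : Vector Carrier (suc s))
    (A≈a : ∀ i → A i ≈ a i · 1#) (m+u≈0 : ∀ i → m i · 1# + u i ≈ 0#) where
    open MultipartiteSpectrum F a m using (sum-const; module Eigenvector)
    open Eigenvector v Dv≈xv

    f : Vector Carrier (suc s)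
    f i = z + u i

    fP+uS≈0 : ∀ i j → f i * P i j + u i * S ≈ 0#
    fP+uS≈0 i j = begin
      f i * P i j + u i * S
        ≈⟨ solve 4 (λ z u P S → (z :+ u) :* P :+ u :* S := z :* P :+ u :* (S :+ P))
             refl z (u i) (P i j) S ⟩
      z * P i j + u i * (S + P i j)
        ≈⟨ +-congʳ (zP≈m[S+P] i j) ⟩
      m i · 1# * (S + P i j) + u i * (S + P i j)
        ≈⟨ distribʳ (S + P i j) (m i · 1#) (u i) ⟨
      (m i · 1# + u i) * (S + P i j)
        ≈⟨ *-congʳ (m+u≈0 i) ⟩
      0# * (S + P i j)
        ≈⟨ zeroˡ _ ⟩
      0# ∎

    fΣP+AuS≈0 : ∀ i → f i * Σ# (P i) + A i * (u i * S) ≈ 0#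
    fΣP+AuS≈0 i = begin
      f i * Σ# (P i) + A i * (u i * S)
        ≈⟨ +-cong (*-distribˡ-sum (f i) (P i))
                  (trans (*-congʳ (A≈a i)) (sym (sum-const (a i) _))) ⟩
      Σ# (λ j → f i * P i j) + Σ# {a i} (λ _ → u i * S)
        ≈⟨ ∑-distrib-+ {a i} _ _ ⟨
      Σ# (λ j → f i * P i j + u i * S)
        ≈⟨ sum-zero {a i} (fP+uS≈0 i) ⟩
      0# ∎

    -- This is the characteristic polynomial, at z, of the quotient of D + 2 I by vertex types: a
    -- diagonal matrix with entries m i plus the rank-one matrix with entries a l m l.
    secular : Carrier
    secular = Π# f + Σ# (λ i → A i * u i * Π# (removeAt f i))

    secular*S≈0 : secular * S ≈ 0#
    secular*S≈0 = begin
      secular * S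
        ≈⟨ distribʳ S _ _ ⟩
      Π# f * S + Σ# (λ i → A i * u i * Π# (removeAt f i)) * S
        -- In the first term S is unfolded as the sum of `Σ# (P i)`, so that both terms become sums
        -- over i.
        ≈⟨ +-cong (*-distribˡ-sum {suc s} (Π# f) (λ i → Σ# (P i)))
                  (*-distribʳ-sum S (λ i → A i * u i * Π# (removeAt f i))) ⟩
      Σ# (λ i → Π# f * Σ# (P i)) + Σ# (λ i → A i * u i * Π# (removeAt f i) * S)
        ≈⟨ ∑-distrib-+ (λ i → Π# f * Σ# (P i))
                       (λ i → A i * u i * Π# (removeAt f i) * S) ⟨
      Σ# (λ i → Π# f * Σ# (P i) + A i * u i * Π# (removeAt f i) * S)
        ≈⟨ sum-zero summand ⟩
      0# ∎
      where
      summand : ∀ i → Π# f * Σ# (P i) + A i * u i * Π# (removeAt f i) * S ≈ 0#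
      summand i = begin
        Π# f * Σ# (P i) + A i * u i * Π# (removeAt f i) * S
          ≈⟨ +-congʳ (*-congʳ (sum-remove {i = i} f)) ⟩
        f i * Π# (removeAt f i) * Σ# (P i) + A i * u i * Π# (removeAt f i) * S
          ≈⟨ solve 6 (λ f Π ΣP A u S → f :* Π :* ΣP :+ A :* u :* Π :* S
               := Π :* (f :* ΣP :+ A :* (u :* S)))
               refl (f i) (Π# (removeAt f i)) (Σ# (P i)) (A i) (u i) S ⟩
        Π# (removeAt f i) * (f i * Σ# (P i) + A i * (u i * S))
          ≈⟨ *-congˡ (fΣP+AuS≈0 i) ⟩
        Π# (removeAt f i) * 0#
          ≈⟨ zeroʳ _ ⟩
        0# ∎

    V-annihilated : ∀ i j k → V (i , j , k) * (z * (f i * secular)) ≈ 0#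
    V-annihilated i j k = begin
      V (i , j , k) * (z * (f i * secular))
        ≈⟨ +-identityʳ _ ⟨
      V (i , j , k) * (z * (f i * secular)) + 0#
        -- The added zero is what later completes f P to f P + u S, which vanishes.
        ≈⟨ +-congˡ (trans (*-congˡ secular*S≈0) (zeroʳ (u i))) ⟨
      V (i , j , k) * (z * (f i * secular)) + u i * (secular * S)
        ≈⟨ solve 6 (λ V z f G u S → V :* (z :* (f :* G)) :+ u :* (G :* S)
             := (z :* V) :* (f :* G) :+ u :* (G :* S))
             refl (V (i , j , k)) z (f i) secular (u i) S ⟩
      z * V (i , j , k) * (f i * secular) + u i * (secular * S)
        ≈⟨ +-congʳ (*-congʳ (zV≈S+P i j k)) ⟩
      (S + P i j) * (f i * secular) + u i * (secular * S)
        ≈⟨ solve 5 (λ f G u S P → (S :+ P) :* (f :* G) :+ u :* (G :* S)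
             := f :* (G :* S) :+ G :* (f :* P :+ u :* S))
             refl (f i) secular (u i) S (P i j) ⟩
      f i * (secular * S) + secular * (f i * P i j + u i * S)
        ≈⟨ +-cong (*-congˡ secular*S≈0) (*-congˡ (fP+uS≈0 i j)) ⟩
      f i * 0# + secular * 0#
        ≈⟨ +-cong (zeroʳ (f i)) (zeroʳ secular) ⟩
      0# + 0#
        ≈⟨ +-identityˡ 0# ⟩
      0# ∎

-- Factorisation of the secular polynomial by normalisation

module SecularPolynomial {c ℓ} (R : CommutativeSemiring c ℓ)
  {s n} (p α β : Vector ℕ (suc s)) (γ δ : Vector ℕ n) where
  open CommutativeSemiring R
  open SemiringMult semiring using (×-homo-+; ×-homo-1; ×1-homo-*) renaming (_×_ to _·_)
  open SemiringSum semiring using (sum-cong-≋) renaming (sum to Σ#)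
  open CommutativeMonoidSum *-commutativeMonoid using () renaming (sum to Π#)

  private
    -- Coefficients in ℕ compute, so normal forms can be compared over an arbitrary R. Negation is
    -- `id` because it is the identity in `fromCommutativeSemiring`.
    ℕ-rawRing : RawRing _ _
    ℕ-rawRing = record
      { Carrier = ℕ ; _≈_ = _≡_ ; _+_ = ℕ._+_ ; _*_ = ℕ._*_ ; -_ = id ; 0# = 0 ; 1# = 1 }

    fromℕ : ℕ-rawRing -Raw-AlmostCommutative⟶ fromCommutativeSemiring R
    fromℕ = record
      { ⟦_⟧    = _· 1#
      ; +-homo = ×-homo-+ 1#
      ; *-homo = ×1-homo-*
      ; -‿homo = λ _ → refl
      ; 0-homo = refl
      ; 1-homo = ×-homo-1 1#
      }

    _≟ᶜ_ : ∀ m n → Maybe (m · 1# ≈ n · 1#)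
    m ≟ᶜ n = map (λ m≡n → reflexive (≡.cong (_· 1#) m≡n)) (dec⇒weaklyDec ℕ._≟_ m n)

  open RingSolver ℕ-rawRing (fromCommutativeSemiring R) fromℕ _≟ᶜ_
    using (Polynomial; con; var; ⟦_⟧; _:+_; _:*_; normalise; _≈N_; _≟N_; ⟦_⟧N-cong; prove)

  Σₚ Πₚ : ∀ {k n} → Vector (Polynomial k) n → Polynomial k
  Σₚ = foldr _:+_ (con 0)
  Πₚ = foldr _:*_ (con 1)

  ⟦Σₚ⟧ : ∀ {k n} (P : Vector (Polynomial k) n) ρ → ⟦ Σₚ P ⟧ ρ ≈ Σ# (λ i → ⟦ P i ⟧ ρ)
  ⟦Σₚ⟧ {n = zero}  P ρ = refl
  ⟦Σₚ⟧ {n = suc n} P ρ = +-congˡ (⟦Σₚ⟧ (P ∘ suc) ρ)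

  ⟦Πₚ⟧ : ∀ {k n} (P : Vector (Polynomial k) n) ρ → ⟦ Πₚ P ⟧ ρ ≈ Π# (λ i → ⟦ P i ⟧ ρ)
  ⟦Πₚ⟧ {n = zero}  P ρ = ×-homo-1 1#
  ⟦Πₚ⟧ {n = suc n} P ρ = *-congˡ (⟦Πₚ⟧ (P ∘ suc) ρ)

  -- The variables are z, w and τ, in this order.
  factorₚ : Vector (Polynomial 3) (suc s)
  factorₚ i = var 0F :+ con (p i) :* var 1F

  affineₚ : ℕ → ℕ → Polynomial 3
  affineₚ k l = con k :* var 2F :+ con l

  partₚ : Vector (Polynomial 3) (suc s)
  partₚ i = (affineₚ (α i) (β i) :* (con (p i) :* var 1F)) :* Πₚ (removeAt factorₚ i)

  rootₚ : Vector (Polynomial 3) n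
  rootₚ l = var 0F :+ affineₚ (γ l) (δ l) :* var 1F

  secularₚ : Polynomial 3
  secularₚ = Πₚ factorₚ :+ Σₚ partₚ

  affine : Carrier → ℕ → ℕ → Carrier
  affine τ k l = k · 1# * τ + l · 1#

  -- The secular polynomial of the parts, of sizes p i q and multiplicities
  -- α i t + β i, has the roots (γ l t + δ l) q.  Since w stands for - q, no
  -- subtraction occurs.
  Factorises : Set _
  Factorises = ∀ z w τ →
    Π# (λ i → z + p i · 1# * w) +
      Σ# (λ i → affine τ (α i) (β i) * (p i · 1# * w) * Π# (removeAt (λ l → z + p l · 1# * w) i))
    ≈ Π# (λ l → z + affine τ (γ l) (δ l) * w)

  -- Equal normal forms have equal values; the other steps exchange the syntactic sums and products
  -- for those in R.
  factorises : normalise secularₚ ≈N normalise (Πₚ rootₚ) → Factorises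
  factorises eq z w τ = begin
    _                  ≈⟨ +-cong (⟦Πₚ⟧ factorₚ ρ) (sum-cong-≋ (λ i →
                            *-congˡ {x = affine τ (α i) (β i) * (p i · 1# * w)}
                              (⟦Πₚ⟧ (removeAt factorₚ i) ρ))) ⟨
    _                  ≈⟨ +-congˡ (⟦Σₚ⟧ partₚ ρ) ⟨
    ⟦ secularₚ ⟧ ρ     ≈⟨ prove ρ secularₚ (Πₚ rootₚ) (⟦ eq ⟧N-cong ρ) ⟩
    ⟦ Πₚ rootₚ ⟧ ρ     ≈⟨ ⟦Πₚ⟧ rootₚ ρ ⟩
    _                  ∎
    where
    open ≈-Reasoning setoid
    ρ : Vec Carrier 3
    ρ = z Vec.∷ w Vec.∷ τ Vec.∷ Vec.[]

  factorises? : Maybe Factorises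
  factorises? = map factorises (normalise secularₚ ≟N normalise (Πₚ rootₚ))

-- Separation of the roots and integrality of the eigenvalues

open import Data.Nat.Base using (_+_; _*_; _<_; _≤_)

-- For a vertex of type i the candidates for z / q are 0, p i and the γ l t + δ l, all affine in t.
-- Weakly ordered slopes with strictly ordered constants separate two of them for every t, and this
-- is a finite check.
RootsOrdered : ∀ {s n} (p : Vector ℕ s) (γ δ : Vector ℕ n) → Set
RootsOrdered {s} {n} p γ δ = ∀ (i : Fin s) (j k : Fin (2 + n)) → j ≡ k ⊎ j ≺[ i ] k ⊎ k ≺[ i ] j
  where
  _≺[_]_ : Fin (2 + n) → Fin s → Fin (2 + n) → Set
  j ≺[ i ] k = (0 ∷ 0 ∷ γ) j ≤ (0 ∷ 0 ∷ γ) k × (0 ∷ p i ∷ δ) j < (0 ∷ p i ∷ δ) k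

module Spectrum {c ℓ₁ ℓ₂} (F : HeytingField c ℓ₁ ℓ₂) (char0 : Eigenvalues.CharacteristicZero F)
  {s n} (p α β : Vector ℕ (suc s)) (γ δ : Vector ℕ n) (t q : ℕ) (0<q : 0 < q)
  (a : Vector ℕ (suc s)) (a≡αt+β : ∀ i → a i ≡ α i * t + β i)
  (roots-ordered : RootsOrdered p γ δ)
  (factorises : SecularPolynomial.Factorises
    (CommutativeRing.commutativeSemiring (commutativeRingOf F)) p α β γ δ) where
  open HeytingField F hiding (zero; _+_; _*_)
  open HeytingField F using () renaming (_+_ to infixl 6 _⊕_; _*_ to infixl 7 _⊛_)
  open Eigenvalues F using (_·_; fromℤ)
  open FieldProperties F
  open HeytingProperties heytingCommutativeRing using (x-0≈x)
  open CommutativeRing (commutativeRingOf F)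
    using (semiring; ring; commutativeSemiring; *-commutativeMonoid)
  open CommutativeMonoidSum *-commutativeMonoid
    using () renaming (sum to Π#; sum-cong-≋ to Π-cong)
  open SemiringMult semiring using (×-homo-+; ×1-homo-*)
  open RingProperties ring using (-‿distribʳ-*; +-cancelʳ)
  open SecularPolynomial commutativeSemiring p α β γ δ using (affine)
  open ≈-Reasoning setoid

  m : Vector ℕ (suc s)
  m i = p i * q
  open CompleteMultipartite a m using (distanceMatrix)
  open Graph (K a m) using (order; vertex)

  w τ : Carrier
  w = - (q · 1#)
  τ = t · 1#

  -[nq]≈nw : ∀ n → - ((n * q) · 1#) ≈ n · 1# ⊛ w
  -[nq]≈nw n = trans (-‿cong (×1-homo-* n q)) (-‿distribʳ-* (n · 1#) (q · 1#))

  affine-· : ∀ k l → (k * t + l) · 1# ≈ affine τ k l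
  affine-· k l = trans (×-homo-+ 1# (k * t) l) (+-congʳ (×1-homo-* k t))

  ρℕ : Fin (suc s) → Vector ℕ (2 + n)
  ρℕ i k = ((0 ∷ 0 ∷ γ) k * t + (0 ∷ p i ∷ δ) k) * q

  ρ : Fin (suc s) → Vector Carrier (2 + n)
  ρ i k = ρℕ i k · 1#

  ρℕ-< : ∀ i j k → (0 ∷ 0 ∷ γ) j ≤ (0 ∷ 0 ∷ γ) k → (0 ∷ p i ∷ δ) j < (0 ∷ p i ∷ δ) k →
         ρℕ i j < ρℕ i k
  ρℕ-< i j k γ≤ δ< = ℕ.*-monoˡ-< q {{ℕ.>-nonZero 0<q}} (ℕ.+-mono-≤-< (ℕ.*-monoˡ-≤ t γ≤) δ<)

  ρ# : ∀ i j k → j ≢ k → ρ i j # ρ i k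
  ρ# i j k j≢k =
    [ (λ j≡k → contradiction j≡k j≢k)
    , [ (λ (γ≤ , δ<) → #-sym (<⇒·1# char0 (ρℕ-< i j k γ≤ δ<)))
      , (λ (γ≥ , δ>) → <⇒·1# char0 (ρℕ-< i k j γ≥ δ>)) ]′
    ]′ (roots-ordered i j k)

  module _ {x} (v : Vector Carrier order)
    (Dv≈xv : ∀ i → Eigenvalues.sum F (λ j → (distanceMatrix i j · 1#) ⊛ v j) ≈ x ⊛ v i) where
    open MultipartiteSpectrum.Eigenvector F a m v Dv≈xv using (z; V; V-vertex)

    A u : Vector Carrier (suc s)
    A i = affine τ (α i) (β i)
    u i = p i · 1# ⊛ w

    A≈a : ∀ i → A i ≈ a i · 1#
    A≈a i = trans (sym (affine-· (α i) (β i))) (reflexive (≡.cong (_· 1#) (≡.sym (a≡αt+β i))))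

    m+u≈0 : ∀ i → m i · 1# ⊕ u i ≈ 0#
    m+u≈0 i = trans (+-congˡ (sym (-[nq]≈nw (p i)))) (-‿inverseʳ (m i · 1#))

    open SecularEquation F a m using (V-annihilated; secular)

    sec : Carrier
    sec = secular v Dv≈xv A u A≈a m+u≈0

    z-ρ₀ : ∀ i → z - ρ i 0F ≈ z
    z-ρ₀ i = x-0≈x z

    z-ρ₁ : ∀ i → z - ρ i 1F ≈ z ⊕ p i · 1# ⊛ w
    z-ρ₁ i = +-congˡ (-[nq]≈nw (p i))

    Π[z-ρ] : ∀ i → Π# (λ l → z - ρ i (suc (suc l))) ≈ sec
    Π[z-ρ] i = begin
      Π# (λ l → z - ρ i (suc (suc l)))
        ≈⟨ Π-cong {n} (λ l → +-congˡ (trans (-[nq]≈nw (γ l * t + δ l))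
             (*-congʳ (affine-· (γ l) (δ l))))) ⟩
      Π# (λ l → z ⊕ affine τ (γ l) (δ l) ⊛ w)
        ≈⟨ factorises z w τ ⟨
      sec ∎

    -- The entry `V u` serves as cofactor y, and `Π[z-ρ]` rewrites the secular factor as the product
    -- over the last candidates.
    V-root : ∀ u → V u # 0# → ∃[ i ] ∃[ κ ] z ≈ ρ i κ
    V-root (i , j , k) V#0 = i , root-factors (ρ i) (ρ# i) (z-ρ₀ i) (z-ρ₁ i) (Π[z-ρ] i) V#0
      (V-annihilated v Dv≈xv A u A≈a m+u≈0 i j k)

    -- Here x = z - 2 may be negative, since r may be 0; hence the integer difference `r ⊖ 2`.
    z-integral : ∀ r → z ≈ r · 1# → x ≈ fromℤ (r ⊖ 2)
    z-integral r z≈r = +-cancelʳ (1# ⊕ 1#) x (fromℤ (r ⊖ 2)) (begin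
      x ⊕ (1# ⊕ 1#)                      ≈⟨ z≈r ⟩
      r · 1#                             ≈⟨ fromℤ-⊖ r 2 ⟨
      fromℤ (r ⊖ 2) ⊕ (1# ⊕ (1# ⊕ 0#))   ≈⟨ +-congˡ (+-congˡ (+-identityʳ 1#)) ⟩
      fromℤ (r ⊖ 2) ⊕ (1# ⊕ 1#)          ∎)

    integral : ∀ ι → v ι # 0# → ∃[ n ] x ≈ fromℤ n
    integral ι v#0 =
      let i , κ , z≈ρ = V-root (vertex ι) (≡.subst (_# 0#) (≡.sym (V-vertex ι)) v#0)
      in ρℕ i κ ⊖ 2 , z-integral (ρℕ i κ) z≈ρ

-- The numerical family and the criterion data

-- The family is affine in t: a i = α i t + β i and μ l + 2 = γ l t + δ l.
p α β γ δ : Vector ℕ 6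
p = 2 ∷ 5 ∷ 11 ∷ 18 ∷ 21 ∷ 23 ∷ []
α = 418600 ∷ 260015 ∷ 45448 ∷ 52440 ∷ 18837 ∷ 34580 ∷ []
β = 4735 ∷ 2941 ∷ 514 ∷ 593 ∷ 213 ∷ 391 ∷ []
γ = 0 ∷ 0 ∷ 0 ∷ 0 ∷ 0 ∷ 4772040 ∷ []
δ = 3 ∷ 9 ∷ 14 ∷ 20 ∷ 22 ∷ 53981 ∷ []

-- Both sides are affine in t, so comparing slopes and constants suffices. This reduces the
-- criterion equations to numerical ones.
affine-* : ∀ (α β γ δ t : ℕ) (C D r : ℤ) → + α ℤ.* C ≡ D ℤ.* + γ →
  + β ℤ.* C ≡ D ℤ.* (+ δ ℤ.- r ℤ.+ + 2) →
  + (α * t + β) ℤ.* C ≡ D ℤ.* (+ (γ * t + δ) ℤ.- r ℤ.+ + 2)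
affine-* α β γ δ t C D r αC≡Dγ βC≡Dδ = begin
  + (α * t + β) ℤ.* C
    ≡⟨ ≡.cong (ℤ._* C) (pos-affine α β) ⟩
  (+ t ℤ.* + α ℤ.+ + β) ℤ.* C
    ≡⟨ ℤ.*-distribʳ-+ C (+ t ℤ.* + α) (+ β) ⟩
  + t ℤ.* + α ℤ.* C ℤ.+ + β ℤ.* C
    ≡⟨ ≡.cong₂ ℤ._+_ (≡.trans (ℤ.*-assoc (+ t) (+ α) C) (≡.cong (+ t ℤ.*_) αC≡Dγ)) βC≡Dδ ⟩
  + t ℤ.* (D ℤ.* + γ) ℤ.+ D ℤ.* (+ δ ℤ.- r ℤ.+ + 2)
    ≡⟨ ≡.cong (ℤ._+ _) (≡.trans (≡.sym (ℤ.*-assoc (+ t) D (+ γ)))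
         (≡.trans (≡.cong (ℤ._* + γ) (ℤ.*-comm (+ t) D)) (ℤ.*-assoc D (+ t) (+ γ)))) ⟩
  D ℤ.* (+ t ℤ.* + γ) ℤ.+ D ℤ.* (+ δ ℤ.- r ℤ.+ + 2)
    ≡⟨ ℤ.*-distribˡ-+ D _ _ ⟨
  D ℤ.* (+ t ℤ.* + γ ℤ.+ (+ δ ℤ.- r ℤ.+ + 2))
    ≡⟨ ≡.cong (D ℤ.*_) (≡.trans (≡.sym (ℤ.+-assoc (+ t ℤ.* + γ) (+ δ ℤ.- r) (+ 2)))
         (≡.cong (ℤ._+ + 2) (≡.trans (≡.sym (ℤ.+-assoc (+ t ℤ.* + γ) (+ δ) (ℤ.- r)))
           (≡.cong (ℤ._- r) (≡.sym (pos-affine γ δ)))))) ⟩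
  D ℤ.* (+ (γ * t + δ) ℤ.- r ℤ.+ + 2) ∎
  where
  open ≡.≡-Reasoning
  pos-affine : ∀ m n → + (m * t + n) ≡ + t ℤ.* + m ℤ.+ + n
  pos-affine m n = ≡.cong (ℤ._+ + n) (≡.trans (ℤ.pos-* m t) (ℤ.*-comm (+ m) (+ t)))

module Family (t : ℕ) where
  a : Vector ℕ 6
  a = (418600 * t + 4735) ∷ (260015 * t + 2941) ∷ (45448 * t + 514)
    ∷ (52440 * t + 593) ∷ (18837 * t + 213) ∷ (34580 * t + 391) ∷ []

  μ : Vector ℤ 6
  μ = + 1 ∷ + 7 ∷ + 12 ∷ + 18 ∷ + 20 ∷ + (4772040 * t + 53979) ∷ []

  a≡αt+β : ∀ i → a i ≡ α i * t + β i
  a≡αt+β 0F = ≡.refl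
  a≡αt+β 1F = ≡.refl
  a≡αt+β 2F = ≡.refl
  a≡αt+β 3F = ≡.refl
  a≡αt+β 4F = ≡.refl
  a≡αt+β 5F = ≡.refl

  0<a : ∀ i → 0 < a i
  0<a i = ≡.subst (0 <_) (≡.sym (a≡αt+β i))
    (ℕ.<-≤-trans (from-yes (all? λ i → 0 ℕ.<? β i) i) (ℕ.m≤n+m (β i) (α i * t)))

  a-eq : ∀ k → + a k ℤ.* (+ p k ℤ.* ∏ (removeAt (λ i → + p i ℤ.- + p k) k))
             ≡ ∏ (λ i → μ i ℤ.- + p k ℤ.+ + 2)
  a-eq k = begin
    + a k ℤ.* C k
      ≡⟨ ≡.cong (λ n → + n ℤ.* C k) (a≡αt+β k) ⟩
    + (α k * t + β k) ℤ.* C k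
      -- The constant is that of μ₆, which is 2 less than the last entry of `δ`.
      ≡⟨ affine-* (α k) (β k) 4772040 53979 t (C k) (D k) (+ p k) (αC≡D k) (βC≡D k) ⟩
    D k ℤ.* (+ (4772040 * t + 53979) ℤ.- + p k ℤ.+ + 2)
      -- Only the last factor depends on t; `D k` collects the other five.
      ≡⟨ ℤΠ.sum-init-last (λ i → μ i ℤ.- + p k ℤ.+ + 2) ⟨
    ∏ (λ i → μ i ℤ.- + p k ℤ.+ + 2) ∎
    where
    open ≡.≡-Reasoning
    C D : Fin 6 → ℤ
    C k = + p k ℤ.* ∏ (removeAt (λ i → + p i ℤ.- + p k) k)
    D k = ∏ (init (λ i → μ i ℤ.- + p k ℤ.+ + 2))

    -- These equations force the slope of μ₆: at k = 0 it is 418600 · 344736 / 30240 = 4772040, so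
    -- 9598038 does not satisfy them.
    αC≡D : ∀ k → + α k ℤ.* C k ≡ D k ℤ.* + 4772040
    αC≡D = from-yes (all? λ k → + α k ℤ.* C k ℤ.≟ D k ℤ.* + 4772040)

    βC≡D : ∀ k → + β k ℤ.* C k ≡ D k ℤ.* (+ 53979 ℤ.- + p k ℤ.+ + 2)
    βC≡D = from-yes (all? λ k → + β k ℤ.* C k ℤ.≟ D k ℤ.* (+ 53979 ℤ.- + p k ℤ.+ + 2))

  criterionData : CriterionData a p μ
  criterionData = record
    { p>0     = from-yes (all? λ k → 0 ℕ.<? p k)
    ; a>0     = 0<a
    ; μ>0     = λ { 0F → from-yes (+ 0 ℤ.<? + 1)
                  ; 1F → from-yes (+ 0 ℤ.<? + 7)
                  ; 2F → from-yes (+ 0 ℤ.<? + 12)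
                  ; 3F → from-yes (+ 0 ℤ.<? + 18)
                  ; 4F → from-yes (+ 0 ℤ.<? + 20)
                  ; 5F → <μ₆ (from-yes (0 ℕ.<? 53979)) }
    ; -2<p₁-2 = from-yes (ℤ.- (+ 2) ℤ.<? + 0)
    ; p-2<μ   = λ { 0F → from-yes (+ 0 ℤ.<? + 1)
                  ; 1F → from-yes (+ 3 ℤ.<? + 7)
                  ; 2F → from-yes (+ 9 ℤ.<? + 12)
                  ; 3F → from-yes (+ 16 ℤ.<? + 18)
                  ; 4F → from-yes (+ 19 ℤ.<? + 20)
                  ; 5F → <μ₆ (from-yes (21 ℕ.<? 53979)) }
    ; μ<p-2   = from-yes (all? λ k → μ (inject₁ k) ℤ.<? + p (suc k) ℤ.- + 2)
    ; a-eq    = a-eq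
    }
    where
    <μ₆ : ∀ {n} → n < 53979 → + n ℤ.< + (4772040 * t + 53979)
    <μ₆ n<53979 = +<+ (ℕ.<-≤-trans n<53979 (ℕ.m≤n+m 53979 (4772040 * t)))

  -- The coefficients are the weighted sums of the α i p i and the β i p i. The unweighted sums
  -- 829920 and 9387 count parts instead of vertices.
  Σap≡n : ℕΣ.sum (λ i → a i * p i) ≡ 4772040 * t + 53969
  Σap≡n = begin
    ℕΣ.sum (λ i → a i * p i)
      ≡⟨ ℕΣ.sum-cong-≗ (λ i → ≡.trans (≡.cong (_* p i) (a≡αt+β i)) (expand i)) ⟩
    ℕΣ.sum (λ i → α i * p i * t + β i * p i)
      ≡⟨ ℕΣ.∑-distrib-+ (λ i → α i * p i * t) (λ i → β i * p i) ⟩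
    ℕΣ.sum (λ i → α i * p i * t) + ℕΣ.sum (λ i → β i * p i)
      ≡⟨ ≡.cong (_+ ℕΣ.sum (λ i → β i * p i)) (ℕΣ.*-distribʳ-sum t (λ i → α i * p i)) ⟨
    ℕΣ.sum (λ i → α i * p i) * t + ℕΣ.sum (λ i → β i * p i)
      ≡⟨⟩
    4772040 * t + 53969 ∎
    where
    open ≡.≡-Reasoning
    expand : ∀ i → (α i * t + β i) * p i ≡ α i * p i * t + β i * p i
    expand i = ≡.trans (ℕ.*-distribʳ-+ (p i) (α i * t) (β i)) (≡.cong (_+ β i * p i)
      (≡.trans (ℕ.*-assoc (α i) t (p i))
        (≡.trans (≡.cong (α i *_) (ℕ.*-comm t (p i))) (≡.sym (ℕ.*-assoc (α i) (p i) t)))))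

-- Scaling by q and conclusion

order-scaled : ∀ {s} (a p : Vector ℕ s) q →
               ℕΣ.sum (λ i → a i * (p i * q)) ≡ q * ℕΣ.sum (λ i → a i * p i)
order-scaled a p q = ≡.trans
  (ℕΣ.sum-cong-≗ λ i → ≡.trans (≡.sym (ℕ.*-assoc (a i) (p i) q)) (ℕ.*-comm (a i * p i) q))
  (≡.sym (ℕΣ.*-distribˡ-sum q (λ i → a i * p i)))

roots-ordered : RootsOrdered p γ δ
roots-ordered = from-yes (all? λ i → all? λ j → all? λ k → (j ≟ᶠ k) ⊎-dec
  (((0 ∷ 0 ∷ γ) j ℕ.≤? (0 ∷ 0 ∷ γ) k) ×-dec ((0 ∷ p i ∷ δ) j ℕ.<? (0 ∷ p i ∷ δ) k)) ⊎-dec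
  (((0 ∷ 0 ∷ γ) k ℕ.≤? (0 ∷ 0 ∷ γ) j) ×-dec ((0 ∷ p i ∷ δ) k ℕ.<? (0 ∷ p i ∷ δ) j)))

-- Both sides are monic of degree 6 in z; after division by q⁶, equality at z = p k q is the
-- criterion equation for a k. Here the identity is checked by evaluating normal forms, with t and q
-- symbolic.
secular-factorises : ∀ {c ℓ} (R : CommutativeSemiring c ℓ) →
                     SecularPolynomial.Factorises R p α β γ δ
secular-factorises R = from-just (SecularPolynomial.factorises? R p α β γ δ)

theorem10 : ∀ {c ℓ₁ ℓ₂ : Level} (t q : ℕ) → 0 < q →
    let
      p : Vector ℕ 6
      p = 2 ∷ 5 ∷ 11 ∷ 18 ∷ 21 ∷ 23 ∷ []
      μ : Vector ℤ 6
      μ = + 1 ∷ + 7 ∷ + 12 ∷ + 18 ∷ + 20 ∷ + (4772040 * t + 53979) ∷ []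
      a : Vector ℕ 6
      a = (418600 * t + 4735) ∷ (260015 * t + 2941) ∷ (45448 * t + 514)
        ∷ (52440 * t + 593) ∷ (18837 * t + 213) ∷ (34580 * t + 391) ∷ []
      n : ℕ
      n = 4772040 * t + 53969
      G : Graph
      G = K a (λ i → p i * q)
    in
    CriterionData a p μ
      × n ≡ sum (λ i → a i * p i)
      × Graph.order G ≡ q * n
      × DistanceIntegral c ℓ₁ ℓ₂ G
theorem10 t q 0<q =
  criterionData , ≡.sym Σap≡n , ≡.trans (order-scaled a p q) (≡.cong (q *_) Σap≡n) ,
  distanceMatrix , (λ i j → distance-isDistance neighbour (vertex i) (vertex j)) ,
  λ F char0 x (v , (i , vᵢ#0) , Dv≈xv) → Spectrum.integral F char0 p α β γ δ t q 0<q a a≡αt+β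
    roots-ordered
    (secular-factorises (CommutativeRing.commutativeSemiring (commutativeRingOf F))) v Dv≈xv i vᵢ#0
  where
  open Family t
  open CompleteMultipartite a (λ i → p i * q)
  open Graph (K a (λ i → p i * q)) using (vertex; _~_)

  0<pq : ∀ i → 0 < p i * q
  0<pq i = ℕ.*-mono-≤ (CriterionData.p>0 criterionData i) 0<q

  -- Vertices of different types lie in different parts, so two types are enough to give every
  -- vertex a neighbour.
  neighbour : ∀ u → ∃[ w ] u ~ w
  neighbour (zero  , _) = (1F , fromℕ< (0<a 1F) , fromℕ< (0<pq 1F)) , λ ()
  neighbour (suc _ , _) = (0F , fromℕ< (0<a 0F) , fromℕ< (0<pq 0F)) , λ ()
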